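{- For all positive integers $n\geq 2$ and $t$, the Roman domination number of $S(K_n,t)$ is $$\gamma_R(S(K_n,t))=\begin{cases}2\left\lceil\frac{n^t}{n+1}\right\rceil & \text{if } t \text{ is odd},\\[2pt] 2\left\lceil\frac{n^t}{n+1}\right\rceil-1 & \text{if } t \text{ is even}.\end{cases}$$
   Context: For a positive integer $n$ let $[n]=\{1,\dots,n\}$. For positive integers $n,t$, the Sierpiński graph $S(K_n,t)$ is the simple graph with vertex set $[n]^t$ (words $v_1v_2\cdots v_t$ with $v_i\in[n]$), in which $u_1\cdots u_t$ and $v_1\cdots v_t$ are adjacent if and only if there is $s\in[t]$ with $u_j=v_j$ for all $j<s$, $u_s\neq v_s$, and $u_j=v_s$ and $v_j=u_s$ for all $j>s$. A Roman dominating function on a graph $G=(V,E)$ is a function $f:V\to\{0,1,2\}$ such that every vertex $u$ with $f(u)=0$ has a neighbor $v$ with $f(v)=2$. Its weight is $\sum_{v\in V}f(v)$, and the Roman domination number $\gamma_R(G)$ is the minimum weight of a Roman dominating function on $G$. -}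

module Defs where

open import Data.Nat using (ℕ; zero; suc; _≤_; _^_)
open import Data.Nat.Properties using (+-0-commutativeMonoid; ≤-trans; ≤-reflexive)
open import Algebra.Properties.CommutativeMonoid.Sum +-0-commutativeMonoid
  using (sum; sum-cong-≗)
open import Data.Fin using (Fin; toℕ; _<_)
open import Data.Fin.Patterns using (0F; 1F; 2F)
open import Data.Fin.Properties using (_≟_; _<?_; any?; all?; *↔×)
open import Data.List using (List; [_]; allFin; cartesianProductWith; map; filter)
open import Data.List.Extrema.Nat using (argmin; argmin-all; f[argmin]≤f[xs])
open import Data.List.Membership.Propositional using (_∈_)
open import Data.List.Membership.Propositional.Properties
  using (∈-cartesianProductWith⁺; ∈-allFin; ∈-map⁺; ∈-filter⁺)
import Data.List.Relation.Unary.All as All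
open import Data.List.Relation.Unary.All.Properties using (all-filter)
open import Data.List.Relation.Unary.Any using (here)
open import Data.Product using (Σ-syntax; ∃-syntax; _×_; _,_; uncurry)
open import Data.Product.Function.NonDependent.Propositional using (_×-↔_)
open import Data.Vec using (Vec; []; _∷_; head; tail; lookup; tabulate)
open import Data.Vec.Properties using (lookup∘tabulate)
open import Function using (_∘_; _$_; _↔_; mk↔ₛ′; Inverse)
open import Function.Construct.Composition using (_↔-∘_)
open import Function.Construct.Symmetry using (↔-sym)
open import Function.Construct.Identity using (↔-id)
open import Relation.Binary using (Rel; Symmetric; Irreflexive; Decidable)
open import Relation.Binary.PropositionalEquality
  using (_≡_; _≢_; refl; sym; trans; cong; subst)
open import Relation.Nullary using (Dec; yes; no; ¬?; contradiction)
open import Relation.Nullary.Decidable using (map′; _×-dec_; _→-dec_)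
open import Level using (0ℓ)

record FiniteSimpleGraph : Set₁ where
  field
    Vertex      : Set
    order       : ℕ
    finite      : Vertex ↔ Fin order
    Adj         : Rel Vertex 0ℓ
    adj?        : Decidable Adj
    symmetric   : Symmetric Adj
    irreflexive : Irreflexive _≡_ Adj

  index : Vertex → Fin order
  index = Inverse.to finite

  vertex : Fin order → Vertex
  vertex = Inverse.from finite

  vertex∘index : ∀ v → vertex (index v) ≡ v
  vertex∘index v = Inverse.inverseʳ finite refl

module _ (G : FiniteSimpleGraph) where
  open FiniteSimpleGraph G

  Labelling : Set
  Labelling = Vertex → Fin 3

  IsRomanDominating : Labelling → Set
  IsRomanDominating f = ∀ u → f u ≡ 0F → ∃[ v ] Adj u v × f v ≡ 2F

  weight : Labelling → ℕ
  weight f = sum λ i → toℕ (f (vertex i))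

  IsMinimumRomanWeight : ℕ → Set
  IsMinimumRomanWeight k =
    (∃[ f ] IsRomanDominating f × weight f ≡ k) ×
    (∀ f → IsRomanDominating f → k ≤ weight f)

words : ∀ n t → List (Vec (Fin n) t)
words n zero    = [ [] ]
words n (suc t) = cartesianProductWith _∷_ (allFin n) (words n t)

∈-words : ∀ {n t} (w : Vec (Fin n) t) → w ∈ words n t
∈-words []      = here refl
∈-words (a ∷ w) = ∈-cartesianProductWith⁺ _∷_ (∈-allFin a) (∈-words w)

module _ (G : FiniteSimpleGraph) where
  open FiniteSimpleGraph G

  isRomanDominating? : ∀ f → Dec (IsRomanDominating G f)
  isRomanDominating? f =
    map′ (λ h u → subst P (vertex∘index u) (h (index u))) (λ h i → h (vertex i)) $
    all? λ i → (f (vertex i) ≟ 0F) →-dec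
    map′ (λ (j , p) → vertex j , p)
         (λ (v , p) → index v , subst (Q (vertex i)) (sym (vertex∘index v)) p)
         (any? λ j → adj? (vertex i) (vertex j) ×-dec (f (vertex j) ≟ 2F))
    where
    Q : Vertex → Vertex → Set
    Q u v = Adj u v × f v ≡ 2F
    P : Vertex → Set
    P u = f u ≡ 0F → ∃[ v ] Q u v

  fromVec : Vec (Fin 3) order → Labelling G
  fromVec w = lookup w ∘ index

  -- Every labelling occurs in this list up to pointwise equality.
  labellings : List (Labelling G)
  labellings = map fromVec (words 3 order)

  romanDominating : List (Labelling G)
  romanDominating = filter isRomanDominating? labellings

  -- The constant labelling 1 is Roman dominating, so using it as the default
  -- value of argmin does not affect the minimum.
  γR : ℕ
  γR = weight G (argmin (weight G) (λ _ → 1F) romanDominating)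

  γR-isMinimum : IsMinimumRomanWeight G γR
  γR-isMinimum = (_ , argmin-all (weight G) (λ _ ()) (all-filter isRomanDominating? labellings) , refl)
               , lower
    where
    lower : ∀ f → IsRomanDominating G f → γR ≤ weight G f
    lower f rd = ≤-trans
      (All.lookup (f[argmin]≤f[xs] {f = weight G} (λ _ → 1F) romanDominating)
        (∈-filter⁺ isRomanDominating? (∈-map⁺ fromVec (∈-words w)) rd′))
      (≤-reflexive (sum-cong-≗ (cong toℕ ∘ f′≗f ∘ vertex)))
      where
      w : Vec (Fin 3) order
      w = tabulate (f ∘ vertex)
      f′≗f : ∀ v → fromVec w v ≡ f v
      f′≗f v = trans (lookup∘tabulate (f ∘ vertex) (index v)) (cong f (vertex∘index v))
      rd′ : IsRomanDominating G (fromVec w)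
      rd′ u p with rd u (trans (sym (f′≗f u)) p)
      ... | v , uv , q = v , uv , trans (f′≗f v) q

module _ {n t : ℕ} where

  SierpińskiAdj : Rel (Vec (Fin n) t) 0ℓ
  SierpińskiAdj u v = Σ[ s ∈ Fin t ]
    (∀ j → j < s → lookup u j ≡ lookup v j) ×
    lookup u s ≢ lookup v s ×
    (∀ j → s < j → lookup u j ≡ lookup v s × lookup v j ≡ lookup u s)

  sierpińskiAdj? : Decidable SierpińskiAdj
  sierpińskiAdj? u v = any? λ s →
    all? (λ j → (j <? s) →-dec (lookup u j ≟ lookup v j)) ×-dec
    ¬? (lookup u s ≟ lookup v s) ×-dec
    all? (λ j → (s <? j) →-dec ((lookup u j ≟ lookup v s) ×-dec (lookup v j ≟ lookup u s)))

  sierpińskiAdj-sym : Symmetric SierpińskiAdj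
  sierpińskiAdj-sym (s , before , at , after) =
    s , (λ j j<s → sym (before j j<s)) , at ∘ sym ,
    λ j s<j → let (p , q) = after j s<j in q , p

  sierpińskiAdj-irrefl : Irreflexive _≡_ SierpińskiAdj
  sierpińskiAdj-irrefl refl (s , _ , at , _) = contradiction refl at

Vec↔Fin : ∀ n t → Vec (Fin n) t ↔ Fin (n ^ t)
Vec↔Fin n zero    = mk↔ₛ′ (λ _ → 0F) (λ _ → []) (λ { 0F → refl ; (Fin.suc ()) }) (λ { [] → refl })
Vec↔Fin n (suc t) = ↔-sym *↔× ↔-∘ ((↔-id _ ×-↔ Vec↔Fin n t) ↔-∘ uncons)
  where
  uncons : Vec (Fin n) (suc t) ↔ (Fin n × Vec (Fin n) t)
  uncons = mk↔ₛ′ (λ w → head w , tail w) (uncurry _∷_) (λ _ → refl) (λ { (_ ∷ _) → refl })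

-- The letters 1,…,n are represented by Fin n.
S[K_,_] : ℕ → ℕ → FiniteSimpleGraph
S[K n , t ] = record
  { Vertex      = Vec (Fin n) t
  ; order       = n ^ t
  ; finite      = Vec↔Fin n t
  ; Adj         = SierpińskiAdj
  ; adj?        = sierpińskiAdj?
  ; symmetric   = λ {u} {v} → sierpińskiAdj-sym {x = u} {v}
  ; irreflexive = λ {u} {v} → sierpińskiAdj-irrefl {x = u} {v}
  }

{-# OPTIONS --safe #-}

-- Every vertex has at most n neighbours, so a Roman dominating function of
-- weight W satisfies 2 nᵗ ≤ (n + 1) W. Since nᵗ ≡ ± 1 modulo n + 1, this is
-- already the claimed lower bound.
--
-- For equality, let the letter i act on the n + 1 states nothing, just 1, …,
-- just n as the transposition of nothing and just i, and give label 2 to the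
-- words that lead from just 1 to nothing. These words form a perfect code,
-- except that the extreme vertex 1…1 is not dominated when t is even; it then
-- gets label 1.

module Submission where

open import Defs
open import Data.Nat using (ℕ; zero; suc; _≤_; _^_; z≤n; s≤s; s<s)
import Data.Nat as ℕ
import Data.Nat.Properties as ℕ
open import Data.Nat.Divisibility using (_∣_; _∤_; divides)
open import Data.Nat.Tactic.RingSolver using (solve-∀)
open import Data.Integer using (+_; -_; _+_; _*_; _-_)
import Data.Integer as ℤ
import Data.Integer.DivMod as ℤ
import Data.Integer.Properties as ℤ
open import Data.Rational.Unnormalised using (_/_; ceiling)
open import Algebra.Properties.Semiring.Sum ℕ.+-*-semiring
  using (sum; sum-syntax; sum-cong-≗; sum-remove; ∑-distrib-+; ∑-comm; *-distribˡ-sum)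
open import Data.Fin using (Fin; zero; suc; toℕ; combine; _↑ˡ_; _↑ʳ_; punchIn)
open import Data.Fin.Patterns using (0F; 1F; 2F)
open import Data.Fin.Properties using (_≟_; remQuot-combine; punchInᵢ≢i)
open import Data.Maybe using (Maybe; just; nothing)
open import Data.Maybe.Properties using (just-injective)
open import Data.Product using (_×_; _,_; ∃-syntax)
open import Data.Sum using (_⊎_; inj₁; inj₂)
open import Data.Vec using (Vec; []; _∷_; lookup; replicate)
open import Data.Vec.Properties using (lookup-replicate; ≡-dec; ∷-injectiveˡ; ∷-injectiveʳ)
open import Function using (_∘_; Inverse)
open import Relation.Binary.PropositionalEquality
  using (_≡_; _≢_; refl; sym; trans; cong; cong₂; subst; module ≡-Reasoning)
open import Relation.Nullary using (Dec; yes; no; ¬_; contradiction)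

-- Finite sums

sum-const : ∀ {m} (f : Fin m → ℕ) {b} → (∀ i → f i ≡ b) → sum f ≡ m ℕ.* b
sum-const {zero}  f f≡b = refl
sum-const {suc m} f f≡b = cong₂ ℕ._+_ (f≡b zero) (sum-const (f ∘ suc) (f≡b ∘ suc))

sum-const-except : ∀ {m} (f : Fin (suc m) → ℕ) k {a b} →
  f k ≡ a → (∀ i → i ≢ k → f i ≡ b) → sum f ≡ a ℕ.+ m ℕ.* b
sum-const-except f k fk≡a f≡b = trans (sum-remove {i = k} f)
  (cong₂ ℕ._+_ fk≡a (sum-const _ (λ j → f≡b (punchIn k j) (punchInᵢ≢i k j))))

sum-mono-≤ : ∀ {m} (f g : Fin m → ℕ) → (∀ i → f i ≤ g i) → sum f ≤ sum g
sum-mono-≤ {zero}  f g f≤g = z≤n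
sum-mono-≤ {suc m} f g f≤g =
  ℕ.+-mono-≤ (f≤g zero) (sum-mono-≤ (f ∘ suc) (g ∘ suc) (f≤g ∘ suc))

term≤sum : ∀ {m} (f : Fin m → ℕ) i → f i ≤ sum f
term≤sum f zero    = ℕ.m≤m+n _ _
term≤sum f (suc i) = ℕ.≤-trans (term≤sum (f ∘ suc) i) (ℕ.m≤n+m _ _)

sum-↑ : ∀ m {k} (f : Fin (m ℕ.+ k) → ℕ) →
  sum f ≡ ∑[ i < m ] f (i ↑ˡ k) ℕ.+ ∑[ j < k ] f (m ↑ʳ j)
sum-↑ zero    f = refl
sum-↑ (suc m) f =
  trans (cong (f zero ℕ.+_) (sum-↑ m (f ∘ suc))) (sym (ℕ.+-assoc (f zero) _ _))

sum-combine : ∀ m {k} (f : Fin (m ℕ.* k) → ℕ) →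
  sum f ≡ ∑[ i < m ] ∑[ j < k ] f (combine i j)
sum-combine zero        f = refl
sum-combine (suc m) {k} f =
  trans (sum-↑ k f) (cong (sum (λ j → f (j ↑ˡ m ℕ.* k)) ℕ.+_) (sum-combine m (f ∘ (k ↑ʳ_))))

indicator : ∀ {A : Set} → Dec A → ℕ
indicator (yes _) = 1
indicator (no _)  = 0

indicator-true : ∀ {A : Set} (A? : Dec A) → A → indicator A? ≡ 1
indicator-true (yes _) a = refl
indicator-true (no ¬a) a = contradiction a ¬a

indicator-false : ∀ {A : Set} (A? : Dec A) → ¬ A → indicator A? ≡ 0
indicator-false (yes a) ¬a = contradiction a ¬a
indicator-false (no _)  ¬a = refl

sum-indicator : ∀ {m} {P : Fin m → Set} (P? : ∀ i → Dec (P i)) k →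
  P k → (∀ i → P i → i ≡ k) → ∑[ i < m ] indicator (P? i) ≡ 1
sum-indicator {suc m} P? k Pk unique = trans
  (sum-const-except _ k (indicator-true (P? k) Pk)
    (λ i i≢k → indicator-false (P? i) (i≢k ∘ unique i)))
  (cong suc (ℕ.*-zeroʳ m))

-- The lower bound

module _ (G : FiniteSimpleGraph) where
  open FiniteSimpleGraph G

  -- Discharging: a vertex `v` with label `x` starts with `suc d * x`; if `x` is 2, it sends 2 to
  -- each `neighbour v i` and keeps 2. Afterwards every vertex holds at least 2. Repetitions and
  -- non-neighbours among the values of `neighbour` do no harm, since the amount sent depends only
  -- on `d`.
  2*order≤[1+d]*weight : ∀ {d} → 1 ≤ d →
    (neighbour : Vertex → Fin d → Vertex) →
    (∀ {u v} → Adj u v → ∃[ i ] u ≡ neighbour v i) →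
    ∀ f → IsRomanDominating G f → 2 ℕ.* order ≤ suc d ℕ.* weight G f
  2*order≤[1+d]*weight {d} 1≤d neighbour covers f rd =
    ℕ.+-cancelʳ-≤ (2 ℕ.* ∑two) _ _ (begin
      2 ℕ.* order ℕ.+ 2 ℕ.* ∑two
        ≡⟨ cong₂ ℕ._+_
             (trans (ℕ.*-comm 2 order) (sym (sum-const {order} (λ _ → 2) (λ _ → refl))))
             (*-distribˡ-sum 2 (λ p → d ℕ.* two p)) ⟩
      ∑[ p < order ] 2 ℕ.+ ∑[ p < order ] (2 ℕ.* (d ℕ.* two p))
        ≡⟨ ∑-distrib-+ {order} (λ _ → 2) _ ⟨
      ∑[ p < order ] (2 ℕ.+ 2 ℕ.* (d ℕ.* two p))
        ≤⟨ sum-mono-≤ _ _ (λ p → charge p (f (vertex p)) refl) ⟩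
      ∑[ p < order ] (suc d ℕ.* toℕ (f (vertex p)) ℕ.+ 2 ℕ.* received p)
        ≡⟨ ∑-distrib-+ {order} _ _ ⟩
      ∑[ p < order ] (suc d ℕ.* toℕ (f (vertex p))) ℕ.+ ∑[ p < order ] (2 ℕ.* received p)
        ≡⟨ cong₂ ℕ._+_ (sym (*-distribˡ-sum (suc d) (λ p → toℕ (f (vertex p)))))
             (sym (*-distribˡ-sum 2 received)) ⟩
      suc d ℕ.* weight G f ℕ.+ 2 ℕ.* sum received
        ≡⟨ cong (λ x → suc d ℕ.* weight G f ℕ.+ 2 ℕ.* x) sum-received ⟩
      suc d ℕ.* weight G f ℕ.+ 2 ℕ.* ∑two ∎)
    where
    open ℕ.≤-Reasoning

    two : Fin order → ℕ
    two p = indicator (f (vertex p) ≟ 2F)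

    ∑two : ℕ
    ∑two = ∑[ p < order ] (d ℕ.* two p)

    hits : Fin order → Fin order → Fin d → ℕ
    hits p q i = indicator (index (neighbour (vertex q) i) ≟ p)

    -- Counts the pairs `(q , i)` for which `q` has label 2 and its `i`-th listed neighbour is `p`.
    received : Fin order → ℕ
    received p = ∑[ q < order ] ∑[ i < d ] (two q ℕ.* hits p q i)

    -- After the sums are interchanged, each pair `(q , i)` hits exactly one `p`.
    sum-received : sum received ≡ ∑two
    sum-received = trans
      (∑-comm (λ p q → ∑[ i < d ] (two q ℕ.* hits p q i)))
      (sum-cong-≗ λ q →
      trans (∑-comm (λ p i → two q ℕ.* hits p q i)) (sum-const _ λ i →
        trans (sym (*-distribˡ-sum (two q) (λ p → hits p q i)))
          (trans
            (cong (two q ℕ.*_)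
              (sum-indicator (λ p → index (neighbour (vertex q) i) ≟ p) _ refl (λ _ → sym)))
            (ℕ.*-identityʳ (two q)))))

    1≤received : ∀ p → f (vertex p) ≡ 0F → 1 ≤ received p
    1≤received p fp≡0 with rd (vertex p) fp≡0
    ... | v , adj , fv≡2 with covers adj
    ... | i , p≡nb = begin
      1
        ≡⟨ cong₂ ℕ._*_
             (indicator-true (_ ≟ 2F) (trans (cong f (vertex∘index v)) fv≡2))
             (indicator-true (_ ≟ p)
               (trans
                 (cong index (trans (cong (λ x → neighbour x i) (vertex∘index v)) (sym p≡nb)))
                 (Inverse.inverseˡ finite refl))) ⟨
      two (index v) ℕ.* hits p (index v) i
        ≤⟨ term≤sum (λ i → two (index v) ℕ.* hits p (index v) i) i ⟩
      ∑[ i < d ] (two (index v) ℕ.* hits p (index v) i)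
        ≤⟨ term≤sum (λ q → ∑[ i < d ] (two q ℕ.* hits p q i)) (index v) ⟩
      received p ∎

    -- The balance at one vertex, with what it sends moved to the left to avoid subtraction. Label 0
    -- lives on what it receives, label 1 on `2 ≤ suc d`, and label 2 has exactly enough.
    charge : ∀ p x → f (vertex p) ≡ x →
      2 ℕ.+ 2 ℕ.* (d ℕ.* two p) ≤ suc d ℕ.* toℕ (f (vertex p)) ℕ.+ 2 ℕ.* received p
    charge p 0F eq = begin
      2 ℕ.+ 2 ℕ.* (d ℕ.* two p)
        ≡⟨ cong (λ x → 2 ℕ.+ 2 ℕ.* (d ℕ.* x))
             (indicator-false (_ ≟ 2F) (λ eq′ → contradiction (trans (sym eq) eq′) λ ())) ⟩
      2 ℕ.+ 2 ℕ.* (d ℕ.* 0) ≡⟨ cong (λ x → 2 ℕ.+ 2 ℕ.* x) (ℕ.*-zeroʳ d) ⟩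
      2                     ≤⟨ ℕ.*-monoʳ-≤ 2 (1≤received p eq) ⟩
      2 ℕ.* received p      ≤⟨ ℕ.m≤n+m _ (suc d ℕ.* toℕ (f (vertex p))) ⟩
      suc d ℕ.* toℕ (f (vertex p)) ℕ.+ 2 ℕ.* received p ∎
    charge p 1F eq = begin
      2 ℕ.+ 2 ℕ.* (d ℕ.* two p)
        ≡⟨ cong (λ x → 2 ℕ.+ 2 ℕ.* (d ℕ.* x))
             (indicator-false (_ ≟ 2F) (λ eq′ → contradiction (trans (sym eq) eq′) λ ())) ⟩
      2 ℕ.+ 2 ℕ.* (d ℕ.* 0) ≡⟨ cong (λ x → 2 ℕ.+ 2 ℕ.* x) (ℕ.*-zeroʳ d) ⟩
      2                     ≤⟨ s≤s 1≤d ⟩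
      suc d                 ≡⟨ ℕ.*-identityʳ (suc d) ⟨
      suc d ℕ.* 1           ≡⟨ cong (λ x → suc d ℕ.* toℕ x) eq ⟨
      suc d ℕ.* toℕ (f (vertex p)) ≤⟨ ℕ.m≤m+n _ _ ⟩
      suc d ℕ.* toℕ (f (vertex p)) ℕ.+ 2 ℕ.* received p ∎
    charge p 2F eq = begin
      2 ℕ.+ 2 ℕ.* (d ℕ.* two p)
        ≡⟨ cong (λ x → 2 ℕ.+ 2 ℕ.* (d ℕ.* x)) (indicator-true (_ ≟ 2F) eq) ⟩
      2 ℕ.+ 2 ℕ.* (d ℕ.* 1) ≡⟨ rearrange d ⟩
      suc d ℕ.* 2           ≡⟨ cong (λ x → suc d ℕ.* toℕ x) eq ⟨
      suc d ℕ.* toℕ (f (vertex p)) ≤⟨ ℕ.m≤m+n _ _ ⟩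
      suc d ℕ.* toℕ (f (vertex p)) ℕ.+ 2 ℕ.* received p ∎
      where
      rearrange : ∀ d → 2 ℕ.+ 2 ℕ.* (d ℕ.* 1) ≡ suc d ℕ.* 2
      rearrange = solve-∀

-- Listing the neighbours in a Sierpiński graph

module _ {n : ℕ} where

  word-≟ : ∀ {t} (u v : Vec (Fin n) t) → Dec (u ≡ v)
  word-≟ = ≡-dec _≟_

  -- If w ends in a maximal block of i's preceded by a letter a ≠ i, the
  -- neighbour of w at i is across the edge leaving the copy at that a; every
  -- other i replaces the last letter. (The value at w = i…i is junk.)
  neighbour : ∀ {t} → Vec (Fin n) t → Fin n → Vec (Fin n) t
  neighbour []      i = []
  neighbour (a ∷ w) i with word-≟ w (replicate _ i)
  ... | yes _ = i ∷ replicate _ a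
  ... | no _  = a ∷ neighbour w i

  neighbour-bridge : ∀ {t} a i → neighbour (a ∷ replicate t i) i ≡ i ∷ replicate t a
  neighbour-bridge {t} a i with word-≟ (replicate t i) (replicate t i)
  ... | yes _ = refl
  ... | no ≢  = contradiction refl ≢

  neighbour-∷ : ∀ {t} a (w : Vec (Fin n) t) i → w ≢ replicate t i →
    neighbour (a ∷ w) i ≡ a ∷ neighbour w i
  neighbour-∷ a w i w≢ with word-≟ w (replicate _ i)
  ... | yes eq = contradiction eq w≢
  ... | no _   = refl

  lookup⁻ : ∀ {t} {w : Vec (Fin n) t} {i} → (∀ j → lookup w j ≡ i) → w ≡ replicate t i
  lookup⁻ {w = []}    eq = refl
  lookup⁻ {w = _ ∷ _} eq = cong₂ _∷_ (eq zero) (lookup⁻ (eq ∘ suc))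

  -- Induction on the position of the first difference. The second conclusion strengthens the
  -- induction: it keeps `neighbour` out of its bridge branch when a common letter is put in front.
  neighbour-covers : ∀ {t} {u v : Vec (Fin n) t} → SierpińskiAdj u v →
    ∃[ i ] u ≡ neighbour v i × v ≢ replicate t i
  neighbour-covers {u = b ∷ u} {a ∷ v} (zero , _ , b≢a , after)
    with refl ← lookup⁻ {w = u} (λ j → let p , _ = after (suc j) (s≤s z≤n) in p)
       | refl ← lookup⁻ {w = v} (λ j → let _ , q = after (suc j) (s≤s z≤n) in q)
    = b , sym (neighbour-bridge a b) , λ eq → b≢a (sym (∷-injectiveˡ eq))
  neighbour-covers {u = b ∷ u} {a ∷ v} (suc s , before , at , after)
    with refl ← before zero (s≤s z≤n)
    with i , refl , v≢ ← neighbour-covers {u = u} {v}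
           (s , (λ j j<s → before (suc j) (s<s j<s)) , at , (λ j s<j → after (suc j) (s<s s<j)))
    = i , sym (neighbour-∷ a v i v≢) , v≢ ∘ ∷-injectiveʳ

-- The perfect code

-- The form `k * 2` lets two equal letters be peeled off by computation, and it agrees with the
-- witness in `divides`.
data Parity : ℕ → Set where
  even : ∀ k → Parity (k ℕ.* 2)
  odd  : ∀ k → Parity (suc (k ℕ.* 2))

parity : ∀ t → Parity t
parity zero = even 0
parity (suc t) with parity t
... | even k = odd k
... | odd k  = even (suc k)

module _ {n : ℕ} where

  step : Maybe (Fin n) → Fin n → Maybe (Fin n)
  step nothing  i = just i
  step (just k) i with k ≟ i
  ... | yes _ = nothing
  ... | no _  = just k

  run : ∀ {t} → Maybe (Fin n) → Vec (Fin n) t → Maybe (Fin n)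
  run s []      = s
  run s (i ∷ w) = run (step s i) w

  step-≡ : ∀ i → step (just i) i ≡ nothing
  step-≡ i with i ≟ i
  ... | yes _  = refl
  ... | no i≢i = contradiction refl i≢i

  step-≢ : ∀ {k i} → k ≢ i → step (just k) i ≡ just k
  step-≢ {k} {i} k≢i with k ≟ i
  ... | yes k≡i = contradiction k≡i k≢i
  ... | no _    = refl

  step-involutive : ∀ s i → step (step s i) i ≡ s
  step-involutive nothing  i = step-≡ i
  step-involutive (just k) i with k ≟ i
  ... | yes refl = refl
  ... | no k≢i   = step-≢ k≢i

  run-replicate-even : ∀ k s i → run s (replicate (k ℕ.* 2) i) ≡ s
  run-replicate-even zero    s i = refl
  run-replicate-even (suc k) s i =
    trans (cong (λ s → run s (replicate (k ℕ.* 2) i)) (step-involutive s i))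
          (run-replicate-even k s i)

  run-replicate-odd : ∀ k s i → run s (replicate (suc (k ℕ.* 2)) i) ≡ step s i
  run-replicate-odd k s i = run-replicate-even k (step s i) i

  -- This lets a codeword dominate the other end of its bridge. A constant block acts as the
  -- identity or as one step, according to the parity of its length. The hypothesis then forces `s`
  -- to be `just j` for even `t` and `just i` for odd `t`, and the opposite word sends that state to
  -- `nothing`.
  run-bridge : ∀ t s {i j} → i ≢ j →
    run s (i ∷ replicate t j) ≡ just j → run s (j ∷ replicate t i) ≡ nothing
  run-bridge t s {i} {j} i≢j eq with parity t
  ... | even k = trans (run-replicate-even k (step s j) i)
                       (step-even s (trans (sym (run-replicate-even k (step s i) j)) eq))
    where
    step-even : ∀ s → step s i ≡ just j → step s j ≡ nothing
    step-even nothing  eq = contradiction (just-injective eq) i≢j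
    step-even (just k) eq with k ≟ i
    step-even (just k) ()   | yes _
    step-even (just k) refl | no _ = step-≡ k
  ... | odd k = trans (run-replicate-odd k (step s j) i)
                      (step-odd s (trans (sym (run-replicate-odd k (step s i) j)) eq))
    where
    step-odd : ∀ s → step (step s i) j ≡ just j → step (step s j) i ≡ nothing
    step-odd nothing eq = contradiction (just-injective (trans (sym (step-≢ i≢j)) eq)) i≢j
    step-odd (just k) eq with k ≟ i
    ... | yes refl = trans (cong (λ s → step s i) (step-≢ i≢j)) (step-≡ i)
    ... | no _ with k ≟ j
    step-odd (just k) ()   | no _ | yes _
    step-odd (just k) refl | no _ | no k≢k = contradiction refl k≢k

  bridge-adj : ∀ {t} {i j : Fin n} → i ≢ j →
    SierpińskiAdj (i ∷ replicate t j) (j ∷ replicate t i)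
  bridge-adj {i = i} {j} i≢j =
    zero , (λ _ ()) , i≢j , λ { (suc l) _ → lookup-replicate l j , lookup-replicate l i }

  ∷-adj : ∀ {t} a {u v : Vec (Fin n) t} → SierpińskiAdj u v → SierpińskiAdj (a ∷ u) (a ∷ v)
  ∷-adj a (s , before , at , after) =
    suc s
    , (λ { zero _ → refl ; (suc j) (s≤s j<s) → before j j<s })
    , at
    , λ { (suc j) (s≤s s<j) → after j s<j }

  -- The start state is general because the tail is read from `step s a`. The only possible
  -- exceptions are constant words `i…i` that end in `just i`; a different letter in front of one
  -- yields a bridge whose other end is a codeword.
  run-dominates : ∀ {t} s (w : Vec (Fin n) t) →
    run s w ≡ nothing ⊎
    (∃[ v ] SierpińskiAdj w v × run s v ≡ nothing) ⊎
    (∃[ i ] w ≡ replicate t i × run s w ≡ just i)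
  run-dominates nothing  []  = inj₁ refl
  run-dominates (just i) []  = inj₂ (inj₂ (i , refl , refl))
  run-dominates {suc t} s (a ∷ w) with run-dominates (step s a) w
  ... | inj₁ eq                      = inj₁ eq
  ... | inj₂ (inj₁ (v , adj , eq))   = inj₂ (inj₁ (a ∷ v , ∷-adj a adj , eq))
  ... | inj₂ (inj₂ (i , refl , eq)) with a ≟ i
  ...   | yes refl = inj₂ (inj₂ (i , refl , eq))
  ...   | no a≢i   = inj₂ (inj₁ (i ∷ replicate t a , bridge-adj a≢i , run-bridge t s a≢i eq))

-- Counting codewords

-- The enumeration is the one inside `S[K n , t ]`, so that weights are such sums by definition.
sumWords : ∀ n t → (Vec (Fin n) t → ℕ) → ℕ
sumWords n t g = ∑[ i < n ^ t ] g (Inverse.from (Vec↔Fin n t) i)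

sumWords-suc : ∀ n t g → sumWords n (suc t) g ≡ ∑[ a < n ] sumWords n t (λ w → g (a ∷ w))
sumWords-suc n t g = trans (sum-combine n _) (sum-cong-≗ λ a → sum-cong-≗ λ j →
  cong (λ (b , k) → g (b ∷ Inverse.from (Vec↔Fin n t) k)) (remQuot-combine a j))

accept : ∀ {A : Set} → Maybe A → ℕ
accept nothing  = 1
accept (just _) = 0

codewords : ∀ n t → Maybe (Fin n) → ℕ
codewords n t s = sumWords n t (λ w → accept (run s w))

codewords-suc : ∀ n t s → codewords n (suc t) s ≡ ∑[ a < n ] codewords n t (step s a)
codewords-suc n t s = sumWords-suc n t (λ w → accept (run s w))

module _ (m : ℕ) where
  private n = suc m

  codewords-nothing : ∀ t {b} → (∀ k → codewords n t (just k) ≡ b) →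
    codewords n (suc t) nothing ≡ n ℕ.* b
  codewords-nothing t eq = trans (codewords-suc n t nothing) (sum-const _ eq)

  -- Only the letter `k` moves `just k`, namely to `nothing`; the other `m` letters fix it.
  codewords-just : ∀ t {a b} → codewords n t nothing ≡ a → (∀ k → codewords n t (just k) ≡ b) →
    ∀ k → codewords n (suc t) (just k) ≡ a ℕ.+ m ℕ.* b
  codewords-just t eqᵃ eqᵇ k = trans (codewords-suc n t (just k)) (sum-const-except _ k
    (trans (cong (codewords n t) (step-≡ k)) eqᵃ)
    (λ i i≢k → trans (cong (codewords n t) (step-≢ (i≢k ∘ sym))) (eqᵇ k)))

  -- Letters permute the `n + 1` states, so each word leads to `nothing` from exactly one of them,
  -- and the counts over all start states add up to `n ^ t`. This is the third component. In both
  -- cases `suc q` is the ceiling of `n ^ t` over `n + 1`.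
  EvenCount OddCount : ℕ → ℕ → Set
  EvenCount t q = codewords n t nothing ≡ suc q × (∀ k → codewords n t (just k) ≡ q) ×
                  suc (suc n ℕ.* q) ≡ n ^ t
  OddCount t q = codewords n t nothing ≡ q × (∀ k → codewords n t (just k) ≡ suc q) ×
                 suc n ℕ.* suc q ≡ suc (n ^ t)

  even⇒odd : ∀ {t q} → EvenCount t q → OddCount (suc t) (n ℕ.* q)
  even⇒odd {t} {q} (eqᵃ , eqᵇ , total) =
    codewords-nothing t eqᵇ , codewords-just t eqᵃ eqᵇ ,
    trans (rearrange m q) (cong (λ x → suc (n ℕ.* x)) total)
    where
    rearrange : ∀ m q → suc (suc m) ℕ.* suc (suc m ℕ.* q) ≡
                        suc (suc m ℕ.* suc (suc (suc m) ℕ.* q))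
    rearrange = solve-∀

  odd⇒even : ∀ {t q} → OddCount t q → EvenCount (suc t) (q ℕ.+ m ℕ.* suc q)
  odd⇒even {t} {q} (eqᵃ , eqᵇ , total) =
    codewords-nothing t eqᵇ , codewords-just t eqᵃ eqᵇ ,
    -- The new count is `n * suc q - 1`; adding `n` to both sides removes the subtraction.
    ℕ.+-cancelʳ-≡ n _ _ (begin
      suc (suc n ℕ.* (q ℕ.+ m ℕ.* suc q)) ℕ.+ n ≡⟨ rearrange m q ⟩
      n ℕ.* (suc n ℕ.* suc q)                   ≡⟨ cong (n ℕ.*_) total ⟩
      n ℕ.* suc (n ^ t)                         ≡⟨ ℕ.*-suc n (n ^ t) ⟩
      n ℕ.+ n ℕ.* n ^ t                         ≡⟨ ℕ.+-comm n _ ⟩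
      n ^ suc t ℕ.+ n                           ∎)
    where
    open ≡-Reasoning
    rearrange : ∀ m q → suc (suc (suc m) ℕ.* (q ℕ.+ m ℕ.* suc q)) ℕ.+ suc m ≡
                        suc m ℕ.* (suc (suc m) ℕ.* suc q)
    rearrange = solve-∀

  evenCount : ∀ k → ∃[ q ] EvenCount (k ℕ.* 2) q
  -- The empty word is accepted from `nothing` only.
  evenCount zero = 0 , refl , (λ _ → refl) , cong suc (ℕ.*-zeroʳ m)
  evenCount (suc k) with _ , count ← evenCount k =
    _ , odd⇒even {suc (k ℕ.* 2)} (even⇒odd {k ℕ.* 2} count)

  oddCount : ∀ k → ∃[ q ] OddCount (suc (k ℕ.* 2)) q
  oddCount k with _ , count ← evenCount k = _ , even⇒odd {k ℕ.* 2} count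

  -- The Roman dominating labelling and its weight

  label : ∀ t → Labelling S[K n , t ]
  label t w with run (just 0F) w
  ... | nothing = 2F
  -- The code is tested first: for odd `t` the word of zeros is a codeword and must keep label 2.
  ... | just _ with word-≟ w (replicate t 0F)
  ...   | yes _ = 1F
  ...   | no _  = 0F

  label-code : ∀ {t} w → run (just 0F) w ≡ nothing → label t w ≡ 2F
  label-code w eq with run (just 0F) w
  label-code w refl | nothing = refl

  -- A constant word in `i` acts as the identity or as `step` at `i`, and for `i ≢ 0F` both fix
  -- `just 0F`. Hence only the word of zeros can remain undominated.
  run-extreme : ∀ t (i : Fin n) → run (just 0F) (replicate t i) ≡ just i → i ≡ 0F
  run-extreme t i eq with parity t
  ... | even k = sym (just-injective (trans (sym (run-replicate-even k (just 0F) i)) eq))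
  ... | odd k with trans (sym (run-replicate-odd k (just 0F) i)) eq
  ...   | eq′ with 0F ≟ i
  run-extreme t i eq | odd k | ()  | yes _
  run-extreme t i eq | odd k | eq′ | no _ = sym (just-injective eq′)

  label≡0⇒ : ∀ t w → label t w ≡ 0F → run (just 0F) w ≢ nothing × w ≢ replicate t 0F
  label≡0⇒ t w eq with run (just 0F) w
  label≡0⇒ t w () | nothing
  ... | just _ with word-≟ w (replicate t 0F)
  label≡0⇒ t w () | just _ | yes _
  ...   | no w≢ = (λ ()) , w≢

  label-romanDominating : ∀ t → IsRomanDominating S[K n , t ] (label t)
  label-romanDominating t w eq with label≡0⇒ t w eq | run-dominates (just 0F) w
  ... | run≢ , _ | inj₁ run≡ = contradiction run≡ run≢
  ... | _ | inj₂ (inj₁ (v , adj , run≡)) = v , adj , label-code v run≡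
  ... | _ , w≢ | inj₂ (inj₂ (i , refl , run≡)) =
    contradiction (cong (replicate t) (run-extreme t i run≡)) w≢

  -- An inequality suffices, since the lower bound on weights supplies the converse. It is strict
  -- when the word of zeros is a codeword.
  label≤ : ∀ t w →
    toℕ (label t w) ≤ 2 ℕ.* accept (run (just 0F) w) ℕ.+ indicator (word-≟ w (replicate t 0F))
  label≤ t w with run (just 0F) w
  ... | nothing = ℕ.m≤m+n 2 _
  ... | just _ with word-≟ w (replicate t 0F)
  ...   | yes _ = ℕ.≤-refl
  ...   | no _  = ℕ.≤-refl

  label≤-odd : ∀ k w → toℕ (label (suc (k ℕ.* 2)) w) ≤ 2 ℕ.* accept (run (just 0F) w)
  label≤-odd k w with run (just 0F) w in eq
  ... | nothing = ℕ.≤-refl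
  ... | just _ with word-≟ w (replicate _ 0F)
  -- An odd number of zeros leads from `just 0F` to `nothing`, so label 1 never occurs.
  ...   | yes refl = contradiction (trans (sym eq) (run-replicate-odd k (just 0F) 0F)) λ ()
  ...   | no _     = ℕ.≤-refl

  sum-2*accept : ∀ t →
    sumWords n t (λ w → 2 ℕ.* accept (run (just 0F) w)) ≡ 2 ℕ.* codewords n t (just 0F)
  sum-2*accept t = sym (*-distribˡ-sum {n ^ t} 2 _)

  weight-label≤ : ∀ t → weight S[K n , t ] (label t) ≤ suc (2 ℕ.* codewords n t (just 0F))
  weight-label≤ t = begin
    weight S[K n , t ] (label t)
      ≤⟨ sum-mono-≤ _ _ (λ i → label≤ t (from i)) ⟩
    sumWords n t (λ w → 2 ℕ.* accept (run (just 0F) w) ℕ.+ indicator (word-≟ w (replicate t 0F)))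
      ≡⟨ ∑-distrib-+ {n ^ t} _ _ ⟩
    sumWords n t (λ w → 2 ℕ.* accept (run (just 0F) w)) ℕ.+
    sumWords n t (λ w → indicator (word-≟ w (replicate t 0F)))
      ≡⟨ cong₂ ℕ._+_ (sum-2*accept t)
           (sum-indicator (λ i → word-≟ (from i) (replicate t 0F)) (to (replicate t 0F))
             (inverseʳ refl) (λ i eq → sym (inverseˡ (sym eq)))) ⟩
    2 ℕ.* codewords n t (just 0F) ℕ.+ 1
      ≡⟨ ℕ.+-comm _ 1 ⟩
    suc (2 ℕ.* codewords n t (just 0F)) ∎
    where
    open ℕ.≤-Reasoning
    open Inverse (Vec↔Fin n t) using (to; from; inverseˡ; inverseʳ)

  weight-label≤-odd : ∀ k → let t = suc (k ℕ.* 2) in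
    weight S[K n , t ] (label t) ≤ 2 ℕ.* codewords n t (just 0F)
  weight-label≤-odd k = ℕ.≤-trans
    (sum-mono-≤ _ _ (λ i → label≤-odd k (Inverse.from (Vec↔Fin n (suc (k ℕ.* 2))) i)))
    (ℕ.≤-reflexive (sum-2*accept (suc (k ℕ.* 2))))

  -- Matching the two bounds

  2*n^t≤[1+n]*γR : ∀ t → 2 ℕ.* n ^ t ≤ suc n ℕ.* γR S[K n , t ]
  2*n^t≤[1+n]*γR t with (f , rd , eq) , _ ← γR-isMinimum S[K n , t ] =
    subst (λ x → 2 ℕ.* n ^ t ≤ suc n ℕ.* x) eq
      (2*order≤[1+d]*weight S[K n , t ] (s≤s z≤n) neighbour
        (λ {u} {v} adj → let i , eq , _ = neighbour-covers {u = u} {v} adj in i , eq) f rd)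

  γR≤weight-label : ∀ t → γR S[K n , t ] ≤ weight S[K n , t ] (label t)
  γR≤weight-label t with _ , lower ← γR-isMinimum S[K n , t ] =
    lower (label t) (label-romanDominating t)

  γR-even : ∀ k {q} → EvenCount (k ℕ.* 2) q → γR S[K n , k ℕ.* 2 ] ≡ suc (2 ℕ.* q)
  γR-even k {q} (_ , eqᵇ , total) = ℕ.≤-antisym
    (ℕ.≤-trans (γR≤weight-label t)
      (subst (λ x → weight S[K n , t ] (label t) ≤ suc (2 ℕ.* x)) (eqᵇ 0F) (weight-label≤ t)))
    -- Weight `2 * q` is excluded, as `2 * n ^ t` exceeds `suc n * (2 * q)` by 2.
    (ℕ.*-cancelˡ-< (suc n) _ _ (begin-strict
      suc n ℕ.* (2 ℕ.* q)       <⟨ ℕ.m≤m+n (suc (suc n ℕ.* (2 ℕ.* q))) 1 ⟩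
      suc (suc n ℕ.* (2 ℕ.* q)) ℕ.+ 1 ≡⟨ rearrange m q ⟩
      2 ℕ.* suc (suc n ℕ.* q)   ≡⟨ cong (2 ℕ.*_) total ⟩
      2 ℕ.* n ^ t               ≤⟨ 2*n^t≤[1+n]*γR t ⟩
      suc n ℕ.* γR S[K n , t ]  ∎))
    where
    open ℕ.≤-Reasoning
    t = k ℕ.* 2
    rearrange : ∀ m q → suc (suc (suc m) ℕ.* (2 ℕ.* q)) ℕ.+ 1 ≡ 2 ℕ.* suc (suc (suc m) ℕ.* q)
    rearrange = solve-∀

  γR-odd : 2 ≤ n → ∀ k {q} → OddCount (suc (k ℕ.* 2)) q →
    γR S[K n , suc (k ℕ.* 2) ] ≡ 2 ℕ.* suc q
  γR-odd 2≤n k {q} (_ , eqᵇ , total) = ℕ.≤-antisym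
    (ℕ.≤-trans (γR≤weight-label t)
      (subst (λ x → weight S[K n , t ] (label t) ≤ 2 ℕ.* x) (eqᵇ 0F) (weight-label≤-odd k)))
    (subst (_≤ γR S[K n , t ]) (sym (ℕ.*-suc 2 q))
      -- Weight `2 * q + 1` is excluded: `2 * n ^ t` exceeds `suc n * suc (2 * q)` by `suc n - 2`,
      -- which is positive because `2 ≤ n`. Both sides are raised by 2 to stay in the naturals.
      (ℕ.*-cancelˡ-< (suc n) _ _ (ℕ.+-cancelʳ-< 2 _ _ (begin-strict
        suc n ℕ.* suc (2 ℕ.* q) ℕ.+ 2     <⟨ ℕ.+-monoʳ-< (suc n ℕ.* suc (2 ℕ.* q)) (s≤s 2≤n) ⟩
        suc n ℕ.* suc (2 ℕ.* q) ℕ.+ suc n ≡⟨ rearrange m q ⟩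
        2 ℕ.* (suc n ℕ.* suc q)           ≡⟨ cong (2 ℕ.*_) total ⟩
        2 ℕ.* suc (n ^ t)                 ≡⟨ ℕ.*-suc 2 (n ^ t) ⟩
        2 ℕ.+ 2 ℕ.* n ^ t                 ≡⟨ ℕ.+-comm 2 (2 ℕ.* n ^ t) ⟩
        2 ℕ.* n ^ t ℕ.+ 2                 ≤⟨ ℕ.+-monoˡ-≤ 2 (2*n^t≤[1+n]*γR t) ⟩
        suc n ℕ.* γR S[K n , t ] ℕ.+ 2    ∎))))
    where
    open ℕ.≤-Reasoning
    t = suc (k ℕ.* 2)
    rearrange : ∀ m q → suc (suc m) ℕ.* suc (2 ℕ.* q) ℕ.+ suc (suc m) ≡
                        2 ℕ.* (suc (suc m) ℕ.* suc q)
    rearrange = solve-∀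

-- Integer floors and ceilings from a remainder

floor-unique : ∀ x c d r → x ≡ + r + c * + suc d → r ≤ d → x ℤ./ + suc d ≡ c
floor-unique _ c d r refl r≤d = trans (ℤ.div-pos-is-/ℕ x (suc d)) (ℤ.≤-antisym
  (between (ℤ.≤-<-trans (ℤ.[n/ℕd]*d≤n x (suc d)) x<[1+c]*[1+d]))
  (between (ℤ.≤-<-trans (ℤ.i≤j+i (c * + suc d) (+ r)) (ℤ.n<s[n/ℕd]*d x (suc d)))))
  where
  x = + r + c * + suc d

  -- Applied in both directions: the quotient and `c` each satisfy `y * suc d ≤ x < suc y * suc d`.
  between : ∀ {a b} → a * + suc d ℤ.< ℤ.suc b * + suc d → a ℤ.≤ b
  between {a} {b} lt = subst (a ℤ.≤_) (ℤ.pred-suc b)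
    (ℤ.i<j⇒i≤pred[j] (ℤ.*-cancelʳ-<-nonNeg {a} {ℤ.suc b} (+ suc d) lt))

  x<[1+c]*[1+d] : x ℤ.< ℤ.suc c * + suc d
  x<[1+c]*[1+d] = subst (x ℤ.<_) (sym (ℤ.suc-* c (+ suc d)))
    (ℤ.+-monoˡ-< (c * + suc d) (ℤ.+<+ (s≤s r≤d)))

-- The ceiling is the negated floor of the negated fraction, and `- a` leaves remainder `r` with
-- quotient `- c`.
ceiling-unique : ∀ a c d r → suc d ℕ.* c ≡ a ℕ.+ r → r ≤ d → ceiling (+ a / suc d) ≡ + c
ceiling-unique a c d r eq r≤d =
  trans (cong -_ (floor-unique (- + a) (- + c) d r -a≡r-c*[1+d] r≤d)) (ℤ.neg-involutive (+ c))
  where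
  open ≡-Reasoning
  -a≡r-c*[1+d] : - + a ≡ + r + - + c * + suc d
  -a≡r-c*[1+d] = sym (begin
    + r + - + c * + suc d     ≡⟨ cong (ℤ._+_ (+ r)) (ℤ.neg-distribˡ-* (+ c) (+ suc d)) ⟨
    + r - + c * + suc d       ≡⟨ cong (ℤ._-_ (+ r)) (ℤ.pos-* c (suc d)) ⟨
    + r - + (c ℕ.* suc d)     ≡⟨ cong (λ x → + r - + x) (trans (ℕ.*-comm c (suc d)) eq) ⟩
    + r - + (a ℕ.+ r)         ≡⟨ cong (λ x → + r - + x) (ℕ.+-comm a r) ⟩
    + r - (+ r + + a)         ≡⟨ cong (ℤ._+_ (+ r)) (ℤ.neg-distrib-+ (+ r) (+ a)) ⟩
    + r + (- + r - + a)       ≡⟨ ℤ.+-assoc (+ r) (- + r) (- + a) ⟨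
    + r - + r - + a           ≡⟨ cong (_- + a) (ℤ.+-inverseʳ (+ r)) ⟩
    + 0 - + a                 ≡⟨ ℤ.+-identityˡ (- + a) ⟩
    - + a                     ∎)

theorem3p2 : (n t : ℕ) → 2 ≤ n → 1 ≤ t →
    (2 ∤ t → + γR S[K n , t ] ≡ + 2 * ceiling (+ (n ^ t) / suc n)) ×
    (2 ∣ t → + γR S[K n , t ] ≡ + 2 * ceiling (+ (n ^ t) / suc n) - + 1)
theorem3p2 n@(suc m) t 2≤n _ = oddCase , evenCase
  where
  open ≡-Reasoning

  oddCase : 2 ∤ t → + γR S[K n , t ] ≡ + 2 * ceiling (+ (n ^ t) / suc n)
  oddCase 2∤t with parity t
  ... | even k = contradiction (divides k refl) 2∤t
  ... | odd k with q , count@(_ , _ , total) ← oddCount m k = begin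
    + γR S[K n , suc (k ℕ.* 2) ] ≡⟨ cong +_ (γR-odd m 2≤n k count) ⟩
    + (2 ℕ.* suc q)              ≡⟨ ℤ.pos-* 2 (suc q) ⟩
    + 2 * + suc q
      -- Here `suc n * suc q` exceeds `n ^ t` by 1.
      ≡⟨ cong (ℤ._*_ (+ 2)) (ceiling-unique _ (suc q) n 1 (trans total (ℕ.+-comm 1 _)) (s≤s z≤n)) ⟨
    + 2 * ceiling (+ (n ^ suc (k ℕ.* 2)) / suc n) ∎

  evenCase : 2 ∣ t → + γR S[K n , t ] ≡ + 2 * ceiling (+ (n ^ t) / suc n) - + 1
  evenCase (divides k refl) with q , count@(_ , _ , total) ← evenCount m k = begin
    + γR S[K n , k ℕ.* 2 ]    ≡⟨ cong +_ (γR-even m k count) ⟩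
    + suc (2 ℕ.* q)           ≡⟨ cong (λ x → + x - + 1) (ℕ.*-suc 2 q) ⟨
    + (2 ℕ.* suc q) - + 1     ≡⟨ cong (_- + 1) (ℤ.pos-* 2 (suc q)) ⟩
    + 2 * + suc q - + 1
      -- Here the excess of `suc n * suc q` over `n ^ t` is `n`, the largest that rounding up
      -- allows.
      ≡⟨ cong (λ x → + 2 * x - + 1)
           (ceiling-unique _ (suc q) n n
             (trans (rearrange m q) (cong (ℕ._+ n) total)) ℕ.≤-refl) ⟨
    + 2 * ceiling (+ (n ^ (k ℕ.* 2)) / suc n) - + 1 ∎
    where
    rearrange : ∀ m q → suc (suc m) ℕ.* suc q ≡ suc (suc (suc m) ℕ.* q) ℕ.+ suc m
    rearrange = solve-∀
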